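{- For any positive integer $k$, as formal power series in $q$, $$\sum_{n=0}^{\infty}D_k(n)q^n=\sum_{n=0}^{\infty}q^{nk}(-q^{n+1};q)_\infty=2(-q;q)_\infty\sum_{j=0}^{k-1}(-1)^j(q^{k-j};q)_j+(-1)^k(q;q)_{k-1}.$$
   Context: $D_k(n)$ is the number of partitions of $n$ into non-negative parts (the part $0$ is allowed) in which the smallest part appears exactly $k$ times and no other part is repeated, with the convention $D_k(0)=1$. For $N\ge1$, $(a;q)_N=\prod_{i=0}^{N-1}(1-aq^i)$; also $(a;q)_0=1$ and $(a;q)_\infty=\lim_{N\to\infty}(a;q)_N$. -}

module Defs where

open import Data.Fin.Base as Fin using (toℕ)
open import Data.Integer.Base as ℤ using (ℤ; 0ℤ; 1ℤ)
import Data.Integer.Properties as ℤ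
open import Data.List.Base
  using (List; []; _∷_; length; filter; upTo; cartesianProductWith)
open import Data.List.Membership.Propositional using (_∈_; find; lose)
open import Data.List.Membership.Propositional.Properties
  using (∈-filter⁺; ∈-filter⁻; ∈-cartesianProductWith⁺;
         ∈-cartesianProductWith⁻; ∈-upTo⁺)
open import Data.List.Properties using (∷-injective; filter-none)
open import Data.List.Relation.Unary.All as All using (All; []; _∷_)
open import Data.List.Relation.Unary.AllPairs using ([]; _∷_)
open import Data.List.Relation.Unary.Any as Any using (here; there)
open import Data.List.Relation.Unary.Linked as Linked using (Linked)
open import Data.List.Relation.Unary.Unique.Propositional using (Unique)
import Data.List.Relation.Unary.Unique.Propositional.Properties as Unique
open import Data.Nat.Base
open import Data.Nat.ListAction using (sum)
open import Data.Nat.Properties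
open import Data.Product.Base using (∃-syntax; _×_; _,_; proj₁; proj₂)
open import Function.Base using (_∘_)
open import Function.Bundles using (_⇔_; mk⇔)
open import Relation.Binary.PropositionalEquality
open import Relation.Nullary.Decidable
  using (Dec; yes; no; map′; _×-dec_; ¬?; _→-dec_)
open import Relation.Nullary.Negation using (contradiction)

open import Algebra.Properties.CommutativeMonoid.Sum ℤ.+-0-commutativeMonoid
  using (sum-syntax; sum⁺-syntax; sum-cong-≗; sum-replicate-zero)

------------------------------------------------------------------------
-- Partitions into non-negative parts

multiplicity : ℕ → List ℕ → ℕ
multiplicity x = length ∘ filter (x ≟_)

record IsDPartition (k n : ℕ) (parts : List ℕ) : Set where
  field
    weaklyDecreasing      : Linked _≥_ parts
    total                 : sum parts ≡ n
    smallest              : ℕ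
    smallest∈parts        : smallest ∈ parts
    smallest≤parts        : All (smallest ≤_) parts
    multiplicity-smallest : multiplicity smallest parts ≡ k
    multiplicity-others   : ∀ x → x ≢ smallest → multiplicity x parts ≤ 1

multiplicity-∉ : ∀ x xs → All (x ≢_) xs → multiplicity x xs ≡ 0
multiplicity-∉ x xs x∉xs = cong length (filter-none (x ≟_) x∉xs)

isDPartition? : ∀ k n parts → Dec (IsDPartition k n parts)
isDPartition? k n parts = map′ to from
  (Linked.linked? _≥?_ parts ×-dec (sum parts ≟ n) ×-dec Any.any? smallest? parts)
  where
  Smallest : ℕ → Set
  Smallest m = All (m ≤_) parts × multiplicity m parts ≡ k ×
               All (λ x → x ≢ m → multiplicity x parts ≤ 1) parts

  smallest? : ∀ m → Dec (Smallest m)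
  smallest? m = All.all? (m ≤?_) parts ×-dec (multiplicity m parts ≟ k) ×-dec
    All.all? (λ x → ¬? (x ≟ m) →-dec (multiplicity x parts ≤? 1)) parts

  to : Linked _≥_ parts × sum parts ≡ n × Any.Any Smallest parts →
       IsDPartition k n parts
  to (dec , tot , any) with m , m∈ , m≤ , mult , others ← find any = record
    { weaklyDecreasing      = dec
    ; total                 = tot
    ; smallest              = m
    ; smallest∈parts        = m∈
    ; smallest≤parts        = m≤
    ; multiplicity-smallest = mult
    ; multiplicity-others   = others′
    }
    where
    others′ : ∀ x → x ≢ m → multiplicity x parts ≤ 1
    others′ x x≢m with Any.any? (x ≟_) parts
    ... | yes x∈ = All.lookup others x∈ x≢m
    ... | no  x∉ = ≤-trans (≤-reflexive (multiplicity-∉ x parts x≢parts)) z≤n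
      where
      x≢parts : All (x ≢_) parts
      x≢parts = All.tabulate λ y∈ x≡y → x∉ (subst (_∈ parts) (sym x≡y) y∈)

  from : IsDPartition k n parts →
         Linked _≥_ parts × sum parts ≡ n × Any.Any Smallest parts
  from p = weaklyDecreasing , total , lose smallest∈parts
    ( smallest≤parts , multiplicity-smallest
    , All.tabulate (λ {x} _ → multiplicity-others x))
    where open IsDPartition p

listsOfLength≤ : ℕ → List ℕ → List (List ℕ)
listsOfLength≤ zero    as = [] ∷ []
listsOfLength≤ (suc l) as = [] ∷ cartesianProductWith _∷_ as (listsOfLength≤ l as)

-- The bounds on the entries and on the length lose nothing: see ∈-dPartitions.
dPartitions : ℕ → ℕ → List (List ℕ)
dPartitions k n =
  filter (isDPartition? k n) (listsOfLength≤ (suc k + n) (upTo (suc n)))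

D : ℕ → ℕ → ℕ
D k n = length (dPartitions k n)

∈-listsOfLength≤ : ∀ l {as} xs → length xs ≤ l → All (_∈ as) xs →
                   xs ∈ listsOfLength≤ l as
∈-listsOfLength≤ zero    []       _       _         = here refl
∈-listsOfLength≤ (suc l) []       _       _         = here refl
∈-listsOfLength≤ (suc l) (x ∷ xs) (s≤s p) (x∈ ∷ xs∈) =
  there (∈-cartesianProductWith⁺ _∷_ x∈ (∈-listsOfLength≤ l xs p xs∈))

listsOfLength≤-unique : ∀ l {as} → Unique as → Unique (listsOfLength≤ l as)
listsOfLength≤-unique zero         _   = [] ∷ []
listsOfLength≤-unique (suc l) {as} as! =
  All.tabulate []∉ ∷
  Unique.cartesianProductWith⁺ _∷_ ∷-injective as! (listsOfLength≤-unique l as!)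
  where
  []∉ : ∀ {ys} → ys ∈ cartesianProductWith _∷_ as (listsOfLength≤ l as) → [] ≢ ys
  []∉ ys∈ refl
    with _ , _ , _ , _ , () ← ∈-cartesianProductWith⁻ _∷_ as (listsOfLength≤ l as) ys∈

parts≤sum : ∀ xs → All (_≤ sum xs) xs
parts≤sum []       = []
parts≤sum (x ∷ xs) =
  m≤m+n x (sum xs) ∷ All.map (λ p → ≤-trans p (m≤n+m (sum xs) x)) (parts≤sum xs)

length≤multiplicity+sum : ∀ xs → length xs ≤ multiplicity 0 xs + sum xs
length≤multiplicity+sum []           = z≤n
length≤multiplicity+sum (zero ∷ xs)  = s≤s (length≤multiplicity+sum xs)
length≤multiplicity+sum (suc x ∷ xs) = begin
  suc (length xs)                       ≤⟨ s≤s (length≤multiplicity+sum xs) ⟩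
  suc (multiplicity 0 xs + sum xs)      ≡⟨ +-suc (multiplicity 0 xs) (sum xs) ⟨
  multiplicity 0 xs + suc (sum xs)
    ≤⟨ +-monoʳ-≤ (multiplicity 0 xs) (s≤s (m≤n+m (sum xs) x)) ⟩
  multiplicity 0 xs + suc (x + sum xs)  ∎
  where open ≤-Reasoning

∈-dPartitions : ∀ k n xs → xs ∈ dPartitions k n ⇔ IsDPartition k n xs
∈-dPartitions k n xs = mk⇔
  (proj₂ ∘ ∈-filter⁻ (isDPartition? k n) {xs = candidates})
  (λ p → ∈-filter⁺ (isDPartition? k n)
    (∈-listsOfLength≤ (suc k + n) xs (length≤ p) (parts∈ p)) p)
  where
  candidates : List (List ℕ)
  candidates = listsOfLength≤ (suc k + n) (upTo (suc n))

  zeros≤ : IsDPartition k n xs → multiplicity 0 xs ≤ suc k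
  zeros≤ p with 0 ≟ IsDPartition.smallest p
  ... | yes refl = ≤-trans (≤-reflexive (IsDPartition.multiplicity-smallest p)) (n≤1+n k)
  ... | no  0≢m  = ≤-trans (IsDPartition.multiplicity-others p 0 0≢m) (s≤s z≤n)

  length≤ : IsDPartition k n xs → length xs ≤ suc k + n
  length≤ p = ≤-trans (length≤multiplicity+sum xs)
    (+-mono-≤ (zeros≤ p) (≤-reflexive (IsDPartition.total p)))

  parts∈ : IsDPartition k n xs → All (_∈ upTo (suc n)) xs
  parts∈ p = All.map
    (λ x≤ → ∈-upTo⁺ (s≤s (≤-trans x≤ (≤-reflexive (IsDPartition.total p)))))
    (parts≤sum xs)

dPartitions-unique : ∀ k n → Unique (dPartitions k n)
dPartitions-unique k n = Unique.filter⁺ (isDPartition? k n)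
  (listsOfLength≤-unique (suc k + n) (Unique.upTo⁺ (suc n)))

------------------------------------------------------------------------
-- Formal power series in q over ℤ, given by their coefficients

Series : Set
Series = ℕ → ℤ

infix  8 -ˢ_
infixl 7 _*ˢ_ _·ˢ_
infixl 6 _+ˢ_ _-ˢ_
infix  9 q^_

q^_ : ℕ → Series
(q^ m) n with m ≟ n
... | yes _ = 1ℤ
... | no  _ = 0ℤ

1ˢ : Series
1ˢ = q^ 0

_+ˢ_ _-ˢ_ _*ˢ_ : Series → Series → Series
(f +ˢ g) n = f n ℤ.+ g n
(f -ˢ g) n = f n ℤ.- g n
(f *ˢ g) n = ∑[ i ≤ n ] (f (toℕ i) ℤ.* g (n ∸ toℕ i))

-ˢ_ : Series → Series
(-ˢ f) n = ℤ.- f n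

_·ˢ_ : ℤ → Series → Series
(c ·ˢ f) n = c ℤ.* f n

infixl 5 sumˢ
sumˢ : ℕ → (ℕ → Series) → Series
sumˢ N f n = ∑[ i < N ] f (toℕ i) n

syntax sumˢ N (λ i → f) = ∑ˢ[ i < N ] f

-- Convergence in the q-adic topology: every coefficient is eventually constant.
infix 4 _⟶_
_⟶_ : (ℕ → Series) → Series → Set
s ⟶ f = ∀ n → ∃[ M ] ∀ N → M ≤ N → s N n ≡ f n

HasSum : (ℕ → Series) → Series → Set
HasSum f s = (λ N → ∑ˢ[ i < N ] f i) ⟶ s

infix 9 ⟨_⟩_ ⟨_⟩∞

-- ⟨ a ⟩ N is (a;q)_N.
⟨_⟩_ : Series → ℕ → Series
⟨ a ⟩ zero  = 1ˢ
⟨ a ⟩ suc N = (1ˢ -ˢ a *ˢ q^ N) *ˢ ⟨ a ⟩ N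

-- The limit of ⟨ a ⟩ N: the factors 1 - a qⁱ with i > n do not affect the
-- coefficient of qⁿ.
⟨_⟩∞ : Series → Series
⟨ a ⟩∞ n = (⟨ a ⟩ suc n) n

q^-≢ : ∀ {m n} → m ≢ n → (q^ m) n ≡ 0ℤ
q^-≢ {m} {n} m≢n with m ≟ n
... | yes m≡n = contradiction m≡n m≢n
... | no  _   = refl

sum-zero : ∀ N (t : Fin.Fin N → ℤ) → (∀ i → t i ≡ 0ℤ) → ∑[ i < N ] t i ≡ 0ℤ
sum-zero N t t≡0 = trans (sum-cong-≗ t≡0) (sum-replicate-zero N)

*-q^-low : ∀ a N n → n < N → (a *ˢ q^ N) n ≡ 0ℤ
*-q^-low a N n n<N = sum-zero (suc n) (λ i → a (toℕ i) ℤ.* (q^ N) (n ∸ toℕ i)) λ i →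
  trans (cong (a (toℕ i) ℤ.*_) (q^-≢ {N} {n ∸ toℕ i} (N≢n∸ (toℕ i))))
        (ℤ.*-zeroʳ (a (toℕ i)))
  where
  N≢n∸ : ∀ i → N ≢ n ∸ i
  N≢n∸ i N≡ = <⇒≢ (≤-<-trans (m∸n≤m n i) n<N) (sym N≡)

factor-trivial : ∀ a f N n → n < N → ((1ˢ -ˢ a *ˢ q^ N) *ˢ f) n ≡ f n
factor-trivial a f N n n<N = begin
  ((1ˢ -ˢ a *ˢ q^ N) *ˢ f) n  ≡⟨ cong₂ ℤ._+_ first (sum-zero n _ rest) ⟩
  f n ℤ.+ 0ℤ                  ≡⟨ ℤ.+-identityʳ (f n) ⟩
  f n                         ∎
  where
  open ≡-Reasoning

  first : (1ℤ ℤ.- (a *ˢ q^ N) 0) ℤ.* f n ≡ f n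
  first = trans
    (cong (λ c → (1ℤ ℤ.- c) ℤ.* f n) (*-q^-low a N 0 (≤-<-trans z≤n n<N)))
    (ℤ.*-identityˡ (f n))

  rest : ∀ (i : Fin.Fin n) →
         (1ˢ -ˢ a *ˢ q^ N) (suc (toℕ i)) ℤ.* f (n ∸ suc (toℕ i)) ≡ 0ℤ
  rest i = cong (λ c → (0ℤ ℤ.- c) ℤ.* f (n ∸ suc (toℕ i)))
    (*-q^-low a N (suc (toℕ i)) (≤-<-trans (toℕ<n i) n<N))
    where open import Data.Fin.Properties using (toℕ<n)

⟨⟩-limit : ∀ a → (λ N → ⟨ a ⟩ N) ⟶ ⟨ a ⟩∞
⟨⟩-limit a n = suc n , λ N n<N → stable (≤⇒≤′ n<N)
  where
  stable : ∀ {N} → suc n ≤′ N → (⟨ a ⟩ N) n ≡ (⟨ a ⟩ suc n) n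
  stable ≤′-refl             = refl
  stable (≤′-step {N} n<N) =
    trans (factor-trivial a (⟨ a ⟩ N) N n (≤′⇒≤ n<N)) (stable n<N)

{-# OPTIONS --safe #-}
-- Write E m = (-q^m;q)∞, so that E m = (1 + q^m) E (m+1), and S k = Σ q^{ik} E (i+1).
-- Adding S (k+1) and S k termwise gives Σ q^{ik} E i = 2 E 1 + q^k S k, that is
-- S (k+1) = 2 E 1 - (1 - q^k) S k, while S 1 telescopes to 2 E 1 - 1. The closed form
-- satisfies the same recurrence, because 1 - q^k is the last factor both of
-- (q^{k-j};q)_{j+1} and of (q;q)_k. Finally, q^{ik} E (i+1) counts the partitions
-- whose smallest part i appears exactly k times.
module Submission where

open import Defs
open import Data.Nat.Base using (ℕ; suc; _*_; _∸_; NonZero)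
open import Data.Integer.Base using (+_; -1ℤ; _^_)
open import Data.Product.Base using (_×_)
open import Relation.Binary.PropositionalEquality using (_≗_)

open import Algebra.Bundles using (AbelianGroup)
open import Data.Fin.Base using (toℕ)
open import Data.Integer.Base as ℤ using (0ℤ; 1ℤ)
import Data.Integer.Properties as ℤ
open import Data.Integer.Tactic.RingSolver using (solve-∀)
open import Data.List.Base using (List; []; _∷_; _++_; map; filter; length; replicate)
open import Data.List.Membership.Propositional using (_∈_)
open import Data.List.Membership.Propositional.Properties
  using (∈-++⁻; ∈-++⁺ˡ; ∈-++⁺ʳ; ∈-map⁻; ∈-map⁺; ∈-filter⁺; ∈-filter⁻)
open import Data.List.Membership.Propositional.Properties.WithK using (unique∧set⇒bag)
open import Data.List.Properties
  using (++-cancelʳ; ∷-injectiveʳ; length-++; length-replicate;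
         filter-++; filter-all; filter-accept; filter-reject)
open import Data.List.Relation.Binary.BagAndSetEquality using (∼bag⇒↭)
open import Data.List.Relation.Binary.Permutation.Propositional.Properties using (↭-length)
open import Data.List.Relation.Unary.All as All using (All; []; _∷_)
import Data.List.Relation.Unary.All.Properties as All
open import Data.List.Relation.Unary.AllPairs as AllPairs using (AllPairs; []; _∷_)
import Data.List.Relation.Unary.AllPairs.Properties as AllPairs
open import Data.List.Relation.Unary.Any using (here; there)
open import Data.List.Relation.Unary.Linked.Properties using (AllPairs⇒Linked; Linked⇒AllPairs)
open import Data.List.Relation.Unary.Unique.Propositional using (Unique)
import Data.List.Relation.Unary.Unique.Propositional.Properties as Unique
open import Data.Nat.Base using (zero; _+_; _≤_; _<_; _≥_; _>_; z≤n; s≤s)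
open import Data.Nat.ListAction using (sum)
open import Data.Nat.ListAction.Properties using (sum-++)
open import Data.Nat.Properties
open import Data.Product.Base using (_,_; proj₁; proj₂; ∃-syntax)
open import Data.Sum.Base using (inj₁; inj₂)
open import Function.Base using (_∘_)
open import Function.Bundles using (_⇔_; mk⇔; Equivalence)
open import Relation.Binary.PropositionalEquality
open import Relation.Nullary.Decidable using (yes; no)
open import Relation.Nullary.Negation using (contradiction)


open import Algebra.Properties.CommutativeMonoid.Sum ℤ.+-0-commutativeMonoid
  using (sum-cong-≗)
open import Algebra.Properties.Group (AbelianGroup.group ℤ.+-0-abelianGroup)
  using () renaming (∙-cancelʳ to ℤ-+-cancelʳ)

open ≡-Reasoning

private
  +-interchange : ∀ a b c d → (a ℤ.+ b) ℤ.+ (c ℤ.+ d) ≡ (a ℤ.+ c) ℤ.+ (b ℤ.+ d)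
  +-interchange = solve-∀

-- Multiplication by a power of q

-- Defined by recursion on the exponent and the index rather than as `q^ k *ˢ f`, so that its laws
-- follow by plain induction; `q^-*ˢ` identifies the two.
shift : ℕ → Series → Series
shift zero    f n       = f n
shift (suc k) f zero    = 0ℤ
shift (suc k) f (suc n) = shift k f n

-- Coefficient `n` of q^k f sees only the coefficients of f up to n - k. This bound lets finite
-- products stand for infinite ones, and short partial sums for long ones.
shift-cong-≤ : ∀ k {f g} n → (∀ m → k + m ≤ n → f m ≡ g m) → shift k f n ≡ shift k g n
shift-cong-≤ zero    n       f≡g = f≡g n ≤-refl
shift-cong-≤ (suc k) zero    f≡g = refl
shift-cong-≤ (suc k) (suc n) f≡g = shift-cong-≤ k n λ m k+m≤n → f≡g m (s≤s k+m≤n)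

shift-cong : ∀ k {f g} → f ≗ g → shift k f ≗ shift k g
shift-cong k f≗g n = shift-cong-≤ k n λ m _ → f≗g m

shift-shift : ∀ a b f → shift a (shift b f) ≗ shift (a + b) f
shift-shift zero    b f n       = refl
shift-shift (suc a) b f zero    = refl
shift-shift (suc a) b f (suc n) = shift-shift a b f n

shift-comm : ∀ a b f → shift a (shift b f) ≗ shift b (shift a f)
shift-comm a b f n = begin
  shift a (shift b f) n  ≡⟨ shift-shift a b f n ⟩
  shift (a + b) f n      ≡⟨ cong (λ c → shift c f n) (+-comm a b) ⟩
  shift (b + a) f n      ≡⟨ shift-shift b a f n ⟨
  shift b (shift a f) n  ∎

shift-+ˢ : ∀ k f g → shift k (f +ˢ g) ≗ shift k f +ˢ shift k g
shift-+ˢ zero    f g n       = refl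
shift-+ˢ (suc k) f g zero    = refl
shift-+ˢ (suc k) f g (suc n) = shift-+ˢ k f g n

shift-·ˢ : ∀ k c f → shift k (c ·ˢ f) ≗ c ·ˢ shift k f
shift-·ˢ zero    c f n       = refl
shift-·ˢ (suc k) c f zero    = sym (ℤ.*-zeroʳ c)
shift-·ˢ (suc k) c f (suc n) = shift-·ˢ k c f n

shift-0ˢ : ∀ k n → shift k (λ _ → 0ℤ) n ≡ 0ℤ
shift-0ˢ zero    n       = refl
shift-0ˢ (suc k) zero    = refl
shift-0ˢ (suc k) (suc n) = shift-0ˢ k n

shift-low : ∀ k f n → n < k → shift k f n ≡ 0ℤ
shift-low (suc k) f zero    _         = refl
shift-low (suc k) f (suc n) (s≤s n<k) = shift-low k f n n<k

q^-suc : ∀ k n → (q^ suc k) (suc n) ≡ (q^ k) n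
q^-suc k n with k ≟ n
... | no  k≢n = q^-≢ (k≢n ∘ suc-injective)
... | yes k≡n with suc k ≟ suc n
...   | yes _ = refl
...   | no ¬p = contradiction (cong suc k≡n) ¬p

shift-q^ : ∀ a b → shift a (q^ b) ≗ q^ (a + b)
shift-q^ zero    b n       = refl
shift-q^ (suc a) b zero    = refl
shift-q^ (suc a) b (suc n) = trans (shift-q^ a b n) (sym (q^-suc (a + b) n))

-- Convolution

*ˢ-congʳ : ∀ {f g} h → f ≗ g → f *ˢ h ≗ g *ˢ h
*ˢ-congʳ h f≗g n = sum-cong-≗ {suc n} λ i → cong (ℤ._* h (n ∸ toℕ i)) (f≗g (toℕ i))

*ˢ-congˡ : ∀ f {g h} → g ≗ h → f *ˢ g ≗ f *ˢ h
*ˢ-congˡ f g≗h n = sum-cong-≗ {suc n} λ i → cong (f (toℕ i) ℤ.*_) (g≗h (n ∸ toℕ i))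

-- Peeling off the first summand, `(f *ˢ g) (suc n)` unfolds by computation to
-- `f 0 ℤ.* g (suc n) ℤ.+ ((f ∘ suc) *ˢ g) n`. Hence the induction on `n` with `f` varying, here and
-- in the laws that follow.
*ˢ-distribʳ-+ˢ : ∀ h f g → (f +ˢ g) *ˢ h ≗ f *ˢ h +ˢ g *ˢ h
*ˢ-distribʳ-+ˢ h f g zero    = distrib (f 0) (g 0) (h 0)
  where
  distrib : ∀ a b c → (a ℤ.+ b) ℤ.* c ℤ.+ 0ℤ ≡ (a ℤ.* c ℤ.+ 0ℤ) ℤ.+ (b ℤ.* c ℤ.+ 0ℤ)
  distrib = solve-∀
*ˢ-distribʳ-+ˢ h f g (suc n) = trans
  (cong₂ ℤ._+_ (ℤ.*-distribʳ-+ (h (suc n)) (f 0) (g 0))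
               (*ˢ-distribʳ-+ˢ h (f ∘ suc) (g ∘ suc) n))
  (+-interchange (f 0 ℤ.* h (suc n)) _ (((f ∘ suc) *ˢ h) n) _)

*ˢ-distribˡ-+ˢ : ∀ f g h → f *ˢ (g +ˢ h) ≗ f *ˢ g +ˢ f *ˢ h
*ˢ-distribˡ-+ˢ f g h zero    = distrib (f 0) (g 0) (h 0)
  where
  distrib : ∀ a b c → a ℤ.* (b ℤ.+ c) ℤ.+ 0ℤ ≡ (a ℤ.* b ℤ.+ 0ℤ) ℤ.+ (a ℤ.* c ℤ.+ 0ℤ)
  distrib = solve-∀
*ˢ-distribˡ-+ˢ f g h (suc n) = trans
  (cong₂ ℤ._+_ (ℤ.*-distribˡ-+ (f 0) (g (suc n)) (h (suc n)))
               (*ˢ-distribˡ-+ˢ (f ∘ suc) g h n))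
  (+-interchange (f 0 ℤ.* g (suc n)) _ (((f ∘ suc) *ˢ g) n) _)

·ˢ-*ˢ : ∀ c f g → (c ·ˢ f) *ˢ g ≗ c ·ˢ (f *ˢ g)
·ˢ-*ˢ c f g zero    = assoc c (f 0) (g 0)
  where
  assoc : ∀ c a b → c ℤ.* a ℤ.* b ℤ.+ 0ℤ ≡ c ℤ.* (a ℤ.* b ℤ.+ 0ℤ)
  assoc = solve-∀
·ˢ-*ˢ c f g (suc n) = trans
  (cong₂ ℤ._+_ (ℤ.*-assoc c (f 0) (g (suc n))) (·ˢ-*ˢ c (f ∘ suc) g n))
  (sym (ℤ.*-distribˡ-+ c (f 0 ℤ.* g (suc n)) (((f ∘ suc) *ˢ g) n)))

*ˢ-·ˢ : ∀ c f g → f *ˢ (c ·ˢ g) ≗ c ·ˢ (f *ˢ g)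
*ˢ-·ˢ c f g zero    = swap c (f 0) (g 0)
  where
  swap : ∀ c a b → a ℤ.* (c ℤ.* b) ℤ.+ 0ℤ ≡ c ℤ.* (a ℤ.* b ℤ.+ 0ℤ)
  swap = solve-∀
*ˢ-·ˢ c f g (suc n) = trans
  (cong (ℤ._+_ (f 0 ℤ.* (c ℤ.* g (suc n)))) (*ˢ-·ˢ c (f ∘ suc) g n))
  (swap c (f 0) (g (suc n)) (((f ∘ suc) *ˢ g) n))
  where
  swap : ∀ c a b d → a ℤ.* (c ℤ.* b) ℤ.+ c ℤ.* d ≡ c ℤ.* (a ℤ.* b ℤ.+ d)
  swap = solve-∀

*ˢ-zeroˡ : ∀ g n → ((λ _ → 0ℤ) *ˢ g) n ≡ 0ℤ
*ˢ-zeroˡ g n = sum-zero (suc n) _ λ _ → refl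

*ˢ-identityˡ : ∀ f → 1ˢ *ˢ f ≗ f
*ˢ-identityˡ f zero    = trans (ℤ.+-identityʳ _) (ℤ.*-identityˡ (f 0))
*ˢ-identityˡ f (suc n) = trans
  (cong₂ ℤ._+_ (ℤ.*-identityˡ (f (suc n)))
    (trans (*ˢ-congʳ {1ˢ ∘ suc} {λ _ → 0ℤ} f (λ i → q^-≢ {0} {suc i} λ ()) n) (*ˢ-zeroˡ f n)))
  (ℤ.+-identityʳ _)

*ˢ-identityʳ : ∀ f → f *ˢ 1ˢ ≗ f
*ˢ-identityʳ f zero    = trans (ℤ.+-identityʳ _) (ℤ.*-identityʳ (f 0))
*ˢ-identityʳ f (suc n) = begin
  f 0 ℤ.* (q^ 0) (suc n) ℤ.+ ((f ∘ suc) *ˢ 1ˢ) n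
    ≡⟨ cong₂ ℤ._+_ (trans (cong (f 0 ℤ.*_) (q^-≢ {0} {suc n} λ ())) (ℤ.*-zeroʳ (f 0)))
                   (*ˢ-identityʳ (f ∘ suc) n) ⟩
  0ℤ ℤ.+ f (suc n)  ≡⟨ ℤ.+-identityˡ _ ⟩
  f (suc n)         ∎

shift-*ˢ : ∀ k f g → shift k f *ˢ g ≗ shift k (f *ˢ g)
shift-*ˢ zero    f g n       = refl
shift-*ˢ (suc k) f g zero    = refl
shift-*ˢ (suc k) f g (suc n) = trans (ℤ.+-identityˡ _) (shift-*ˢ k f g n)

-- The left side has one more summand, the last one, and it contains the factor `shift (suc k) g 0`,
-- which is 0.
*ˢ-shift-suc : ∀ k f g n → (f *ˢ shift (suc k) g) (suc n) ≡ (f *ˢ shift k g) n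
*ˢ-shift-suc k f g zero    = cong (ℤ._+_ (f 0 ℤ.* shift k g 0))
  (trans (ℤ.+-identityʳ _) (ℤ.*-zeroʳ (f 1)))
*ˢ-shift-suc k f g (suc n) =
  cong (ℤ._+_ (f 0 ℤ.* shift k g (suc n))) (*ˢ-shift-suc k (f ∘ suc) g n)

*ˢ-shift : ∀ k f g → f *ˢ shift k g ≗ shift k (f *ˢ g)
*ˢ-shift zero    f g n       = refl
*ˢ-shift (suc k) f g zero    = trans (ℤ.+-identityʳ _) (ℤ.*-zeroʳ (f 0))
*ˢ-shift (suc k) f g (suc n) = trans (*ˢ-shift-suc k f g n) (*ˢ-shift k f g n)

q^-*ˢ : ∀ k f → q^ k *ˢ f ≗ shift k f
q^-*ˢ k f n = begin
  (q^ k *ˢ f) n          ≡⟨ cong (λ m → (q^ m *ˢ f) n) (+-identityʳ k) ⟨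
  (q^ (k + 0) *ˢ f) n    ≡⟨ *ˢ-congʳ f (shift-q^ k 0) n ⟨
  (shift k 1ˢ *ˢ f) n    ≡⟨ shift-*ˢ k 1ˢ f n ⟩
  shift k (1ˢ *ˢ f) n    ≡⟨ shift-cong k (*ˢ-identityˡ f) n ⟩
  shift k f n            ∎

-- Finite sums of series

sumˢ-cong : ∀ N (f g : ℕ → Series) n → (∀ i → i < N → f i n ≡ g i n) → sumˢ N f n ≡ sumˢ N g n
sumˢ-cong zero    f g n f≡g = refl
sumˢ-cong (suc N) f g n f≡g =
  cong₂ ℤ._+_ (f≡g 0 (s≤s z≤n)) (sumˢ-cong N (f ∘ suc) (g ∘ suc) n λ i i<N → f≡g (suc i) (s≤s i<N))

sumˢ-+ˢ : ∀ N f g → sumˢ N (λ i → f i +ˢ g i) ≗ sumˢ N f +ˢ sumˢ N g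
sumˢ-+ˢ zero    f g n = refl
sumˢ-+ˢ (suc N) f g n = trans
  (cong (ℤ._+_ (f 0 n ℤ.+ g 0 n)) (sumˢ-+ˢ N (f ∘ suc) (g ∘ suc) n))
  (+-interchange (f 0 n) _ (sumˢ N (f ∘ suc) n) _)

sumˢ-·ˢ : ∀ N c f → sumˢ N (λ i → c ·ˢ f i) ≗ c ·ˢ sumˢ N f
sumˢ-·ˢ zero    c f n = sym (ℤ.*-zeroʳ c)
sumˢ-·ˢ (suc N) c f n = trans
  (cong (ℤ._+_ (c ℤ.* f 0 n)) (sumˢ-·ˢ N c (f ∘ suc) n))
  (sym (ℤ.*-distribˡ-+ c (f 0 n) _))

sumˢ-shift : ∀ N k f → sumˢ N (λ i → shift k (f i)) ≗ shift k (sumˢ N f)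
sumˢ-shift zero    k f n = sym (shift-0ˢ k n)
sumˢ-shift (suc N) k f n = trans
  (cong (ℤ._+_ (shift k (f 0) n)) (sumˢ-shift N k (f ∘ suc) n))
  (sym (shift-+ˢ k (f 0) (sumˢ N (f ∘ suc)) n))

sumˢ-telescope : ∀ (F : ℕ → Series) N n →
  sumˢ N F n ≡ F 0 n ℤ.+ sumˢ N (F ∘ suc) n ℤ.- F N n
sumˢ-telescope F zero    n = cancel (F 0 n)
  where
  cancel : ∀ a → 0ℤ ≡ a ℤ.+ 0ℤ ℤ.- a
  cancel = solve-∀
sumˢ-telescope F (suc N) n = trans
  (cong (ℤ._+_ (F 0 n)) (sumˢ-telescope (F ∘ suc) N n))
  (assoc (F 0 n) (F 1 n) (sumˢ N (F ∘ suc ∘ suc) n) (F (suc N) n))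
  where
  assoc : ∀ a b c d → a ℤ.+ (b ℤ.+ c ℤ.- d) ≡ a ℤ.+ (b ℤ.+ c) ℤ.- d
  assoc = solve-∀

-- q-Pochhammer symbols

-- Treats a = q^m and a = -q^m at once, with c = 1 and c = -1: the factor 1 - a q^N is the binomial
-- 1 - c q^(m+N).
factor : ∀ {a} c m N f → a ≗ c ·ˢ q^ m →
         (1ˢ -ˢ a *ˢ q^ N) *ˢ f ≗ f +ˢ (ℤ.- c) ·ˢ shift (m + N) f
factor {a} c m N f a≗ n = begin
  ((1ˢ -ˢ a *ˢ q^ N) *ˢ f) n
    ≡⟨ *ˢ-congʳ {1ˢ -ˢ a *ˢ q^ N} {1ˢ +ˢ (ℤ.- c) ·ˢ q^ (m + N)} f
         (λ i → cong (ℤ._+_ (1ˢ i)) (monomial i)) n ⟩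
  ((1ˢ +ˢ (ℤ.- c) ·ˢ q^ (m + N)) *ˢ f) n
    ≡⟨ *ˢ-distribʳ-+ˢ f 1ˢ ((ℤ.- c) ·ˢ q^ (m + N)) n ⟩
  (1ˢ *ˢ f) n ℤ.+ (((ℤ.- c) ·ˢ q^ (m + N)) *ˢ f) n
    ≡⟨ cong₂ ℤ._+_ (*ˢ-identityˡ f n)
         (trans (·ˢ-*ˢ (ℤ.- c) (q^ (m + N)) f n)
                (cong (ℤ.- c ℤ.*_) (q^-*ˢ (m + N) f n))) ⟩
  f n ℤ.+ ℤ.- c ℤ.* shift (m + N) f n  ∎
  where
  monomial : ∀ i → ℤ.- (a *ˢ q^ N) i ≡ ℤ.- c ℤ.* (q^ (m + N)) i
  monomial i = begin
    ℤ.- (a *ˢ q^ N) i                 ≡⟨ cong ℤ.-_ (*ˢ-congʳ (q^ N) a≗ i) ⟩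
    ℤ.- ((c ·ˢ q^ m) *ˢ q^ N) i       ≡⟨ cong ℤ.-_ (·ˢ-*ˢ c (q^ m) (q^ N) i) ⟩
    ℤ.- (c ℤ.* (q^ m *ˢ q^ N) i)
      ≡⟨ cong (λ t → ℤ.- (c ℤ.* t)) (trans (q^-*ˢ m (q^ N) i) (shift-q^ m N i)) ⟩
    ℤ.- (c ℤ.* (q^ (m + N)) i)        ≡⟨ ℤ.neg-distribˡ-* c _ ⟩
    ℤ.- c ℤ.* (q^ (m + N)) i          ∎

⟨q^⟩-suc : ∀ m N → ⟨ q^ m ⟩ suc N ≗ ⟨ q^ m ⟩ N -ˢ shift (m + N) (⟨ q^ m ⟩ N)
⟨q^⟩-suc m N n = trans
  (factor 1ℤ m N (⟨ q^ m ⟩ N) (λ i → sym (ℤ.*-identityˡ _)) n)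
  (cong (ℤ._+_ ((⟨ q^ m ⟩ N) n)) (ℤ.-1*i≡-i _))

⟨-q^⟩-suc : ∀ m N → ⟨ -ˢ q^ m ⟩ suc N ≗ ⟨ -ˢ q^ m ⟩ N +ˢ shift (m + N) (⟨ -ˢ q^ m ⟩ N)
⟨-q^⟩-suc m N n = trans
  (factor -1ℤ m N (⟨ -ˢ q^ m ⟩ N) (λ i → sym (ℤ.-1*i≡-i _)) n)
  (cong (ℤ._+_ ((⟨ -ˢ q^ m ⟩ N) n)) (ℤ.*-identityˡ _))

-- The definition of the product exposes its last factor; this exposes the first one, 1 + q^m. In
-- the induction both factors are split off, and the corresponding shifts commute.
⟨-q^⟩-sucˡ : ∀ m N → ⟨ -ˢ q^ m ⟩ suc N ≗
             ⟨ -ˢ q^ suc m ⟩ N +ˢ shift m (⟨ -ˢ q^ suc m ⟩ N)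
⟨-q^⟩-sucˡ m zero    n = trans (⟨-q^⟩-suc m 0 n)
  (cong (λ k → (q^ 0) n ℤ.+ shift k 1ˢ n) (+-identityʳ m))
⟨-q^⟩-sucˡ m (suc N) n = begin
  (⟨ -ˢ q^ m ⟩ suc (suc N)) n
    ≡⟨ ⟨-q^⟩-suc m (suc N) n ⟩
  (⟨ -ˢ q^ m ⟩ suc N) n ℤ.+ shift (m + suc N) (⟨ -ˢ q^ m ⟩ suc N) n
    ≡⟨ cong₂ ℤ._+_ (ih n) (trans (cong (λ k → shift k (⟨ -ˢ q^ m ⟩ suc N) n) (+-suc m N))
                                 (shift-cong s ih n)) ⟩
  (Y n ℤ.+ shift m Y n) ℤ.+ shift s (Y +ˢ shift m Y) n
    ≡⟨ cong (ℤ._+_ (Y n ℤ.+ shift m Y n))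
         (trans (shift-+ˢ s Y (shift m Y) n) (cong (ℤ._+_ (shift s Y n)) (shift-comm s m Y n))) ⟩
  (Y n ℤ.+ shift m Y n) ℤ.+ (shift s Y n ℤ.+ shift m (shift s Y) n)
    ≡⟨ +-interchange (Y n) (shift m Y n) (shift s Y n) _ ⟩
  (Y n ℤ.+ shift s Y n) ℤ.+ (shift m Y n ℤ.+ shift m (shift s Y) n)
    ≡⟨ cong₂ ℤ._+_ (⟨-q^⟩-suc (suc m) N n)
         (trans (shift-cong m (⟨-q^⟩-suc (suc m) N) n) (shift-+ˢ m Y (shift s Y) n)) ⟨
  (⟨ -ˢ q^ suc m ⟩ suc N) n ℤ.+ shift m (⟨ -ˢ q^ suc m ⟩ suc N) n  ∎
  where
  s = suc m + N
  Y = ⟨ -ˢ q^ suc m ⟩ N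
  ih = ⟨-q^⟩-sucˡ m N

-- Every factor is 1 + q^(m+i), whose exponent m + i exceeds n.
⟨-q^⟩-low : ∀ m N n → n < m → (⟨ -ˢ q^ m ⟩ N) n ≡ 1ˢ n
⟨-q^⟩-low m zero    n n<m = refl
⟨-q^⟩-low m (suc N) n n<m = begin
  (⟨ -ˢ q^ m ⟩ suc N) n
    ≡⟨ ⟨-q^⟩-suc m N n ⟩
  (⟨ -ˢ q^ m ⟩ N) n ℤ.+ shift (m + N) (⟨ -ˢ q^ m ⟩ N) n
    ≡⟨ cong₂ ℤ._+_ (⟨-q^⟩-low m N n n<m)
                   (shift-low (m + N) _ n (<-≤-trans n<m (m≤m+n m N))) ⟩
  1ˢ n ℤ.+ 0ℤ
    ≡⟨ ℤ.+-identityʳ (1ˢ n) ⟩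
  1ˢ n  ∎

⟨⟩∞-stable : ∀ a N n → n < N → (⟨ a ⟩ N) n ≡ ⟨ a ⟩∞ n
⟨⟩∞-stable a N n n<N = proj₂ (⟨⟩-limit a n) N n<N

⟨-q^⟩∞-sucˡ : ∀ m → ⟨ -ˢ q^ m ⟩∞ ≗ ⟨ -ˢ q^ suc m ⟩∞ +ˢ shift m ⟨ -ˢ q^ suc m ⟩∞
⟨-q^⟩∞-sucˡ m n = begin
  ⟨ -ˢ q^ m ⟩∞ n
    -- Coefficient `n` of the infinite product is read off from `suc n` factors. One more factor is
    -- taken here, so that `suc n` remain once the first is split off.
    ≡⟨ ⟨⟩∞-stable (-ˢ q^ m) (suc (suc n)) n (s≤s (n≤1+n n)) ⟨
  (⟨ -ˢ q^ m ⟩ suc (suc n)) n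
    ≡⟨ ⟨-q^⟩-sucˡ m (suc n) n ⟩
  (⟨ -ˢ q^ suc m ⟩ suc n) n ℤ.+ shift m (⟨ -ˢ q^ suc m ⟩ suc n) n
    ≡⟨ cong (ℤ._+_ (⟨ -ˢ q^ suc m ⟩∞ n)) (shift-cong-≤ m n λ i m+i≤n →
         ⟨⟩∞-stable (-ˢ q^ suc m) (suc n) i (s≤s (m+n≤o⇒n≤o m m+i≤n))) ⟩
  ⟨ -ˢ q^ suc m ⟩∞ n ℤ.+ shift m ⟨ -ˢ q^ suc m ⟩∞ n  ∎

-- The partial sums and their recurrence in k

partialSum : ℕ → ℕ → Series
partialSum k N = ∑ˢ[ i < N ] shift (i * k) ⟨ -ˢ q^ suc i ⟩∞

-- Since q^(i(k+1)) + q^(ik) = q^(ik) (1 + q^i), each pair of terms supplies the first factor of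
-- (-q^i;q)∞. The case k = 0 is included and serves `partialSum-1`.
partialSum-suc : ∀ k N → partialSum (suc k) N +ˢ partialSum k N ≗
                 ∑ˢ[ i < N ] shift (i * k) ⟨ -ˢ q^ i ⟩∞
partialSum-suc k N n = begin
  partialSum (suc k) N n ℤ.+ partialSum k N n
    ≡⟨ sumˢ-+ˢ N (λ i → shift (i * suc k) (E (suc i))) (λ i → shift (i * k) (E (suc i))) n ⟨
  sumˢ N (λ i → shift (i * suc k) (E (suc i)) +ˢ shift (i * k) (E (suc i))) n
    ≡⟨ sumˢ-cong N (λ i → shift (i * suc k) (E (suc i)) +ˢ shift (i * k) (E (suc i)))
                   (λ i → shift (i * k) (E i)) n (λ i _ → term i) ⟩
  sumˢ N (λ i → shift (i * k) (E i)) n  ∎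
  where
  E : ℕ → Series
  E i = ⟨ -ˢ q^ i ⟩∞

  term : ∀ i → shift (i * suc k) (E (suc i)) n ℤ.+ shift (i * k) (E (suc i)) n ≡
               shift (i * k) (E i) n
  term i = begin
    shift (i * suc k) (E (suc i)) n ℤ.+ shift (i * k) (E (suc i)) n
      ≡⟨ ℤ.+-comm (shift (i * suc k) (E (suc i)) n) _ ⟩
    shift (i * k) (E (suc i)) n ℤ.+ shift (i * suc k) (E (suc i)) n
      ≡⟨ cong (λ m → shift (i * k) (E (suc i)) n ℤ.+ shift m (E (suc i)) n)
           (trans (*-suc i k) (+-comm i (i * k))) ⟩
    shift (i * k) (E (suc i)) n ℤ.+ shift (i * k + i) (E (suc i)) n
      ≡⟨ cong (ℤ._+_ (shift (i * k) (E (suc i)) n)) (shift-shift (i * k) i (E (suc i)) n) ⟨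
    shift (i * k) (E (suc i)) n ℤ.+ shift (i * k) (shift i (E (suc i))) n
      ≡⟨ shift-+ˢ (i * k) (E (suc i)) (shift i (E (suc i))) n ⟨
    shift (i * k) (E (suc i) +ˢ shift i (E (suc i))) n
      ≡⟨ shift-cong (i * k) (⟨-q^⟩∞-sucˡ i) n ⟨
    shift (i * k) (E i) n  ∎

-- The term i = 0 is (-1;q)∞ = 2 (-q;q)∞. In the other terms, reindexing i to i + 1 brings out a
-- factor q^k and leaves a sum with one term fewer, hence `N` against `suc N`.
partialSum-recurrence : ∀ k N → partialSum (suc k) (suc N) +ˢ partialSum k (suc N) ≗
                        (+ 2) ·ˢ ⟨ -ˢ q^ 1 ⟩∞ +ˢ shift k (partialSum k N)
partialSum-recurrence k N n = begin
  partialSum (suc k) (suc N) n ℤ.+ partialSum k (suc N) n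
    ≡⟨ partialSum-suc k (suc N) n ⟩
  ⟨ -ˢ q^ 0 ⟩∞ n ℤ.+ sumˢ N (λ i → shift (k + i * k) ⟨ -ˢ q^ suc i ⟩∞) n
    ≡⟨ cong₂ ℤ._+_ (trans (⟨-q^⟩∞-sucˡ 0 n) (double (⟨ -ˢ q^ 1 ⟩∞ n)))
         (trans (sumˢ-cong N (λ i → shift (k + i * k) ⟨ -ˢ q^ suc i ⟩∞)
                           (λ i → shift k (t i)) n λ i _ →
                  sym (shift-shift k (i * k) ⟨ -ˢ q^ suc i ⟩∞ n))
                (sumˢ-shift N k t n)) ⟩
  + 2 ℤ.* ⟨ -ˢ q^ 1 ⟩∞ n ℤ.+ shift k (partialSum k N) n  ∎
  where
  t : ℕ → Series
  t i = shift (i * k) ⟨ -ˢ q^ suc i ⟩∞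

  double : ∀ a → a ℤ.+ a ≡ + 2 ℤ.* a
  double = solve-∀

-- At k = 0 the sums telescope instead of converging.
partialSum-1 : ∀ N n → n < N → partialSum 1 N n ≡ + 2 ℤ.* ⟨ -ˢ q^ 1 ⟩∞ n ℤ.- 1ˢ n
partialSum-1 N n n<N = ℤ-+-cancelʳ (partialSum 0 N n) _ _ (begin
  partialSum 1 N n ℤ.+ partialSum 0 N n
    ≡⟨ partialSum-suc 0 N n ⟩
  sumˢ N (λ i → shift (i * 0) (E i)) n
    ≡⟨ unshift E ⟩
  sumˢ N E n
    ≡⟨ sumˢ-telescope E N n ⟩
  E 0 n ℤ.+ sumˢ N (E ∘ suc) n ℤ.- E N n
    -- Of the two end terms, `E 0` is twice `E 1`, and `E N` agrees with 1 at coefficient `n`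
    -- because `n < N`. The sum between them is `partialSum 0 N` again and cancels.
    ≡⟨ cong₂ ℤ._-_ (cong₂ ℤ._+_ (⟨-q^⟩∞-sucˡ 0 n) (sym (unshift (E ∘ suc))))
                   (⟨-q^⟩-low N (suc n) n n<N) ⟩
  E 1 n ℤ.+ E 1 n ℤ.+ partialSum 0 N n ℤ.- 1ˢ n
    ≡⟨ rearrange (E 1 n) (partialSum 0 N n) (1ˢ n) ⟩
  + 2 ℤ.* E 1 n ℤ.- 1ˢ n ℤ.+ partialSum 0 N n  ∎)
  where
  E : ℕ → Series
  E i = ⟨ -ˢ q^ i ⟩∞

  unshift : ∀ F → sumˢ N (λ i → shift (i * 0) (F i)) n ≡ sumˢ N F n
  unshift F = sumˢ-cong N (λ i → shift (i * 0) (F i)) F n λ i _ → cong (λ m → shift m (F i) n) (*-zeroʳ i)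

  rearrange : ∀ a b c → a ℤ.+ a ℤ.+ b ℤ.- c ≡ + 2 ℤ.* a ℤ.- c ℤ.+ b
  rearrange = solve-∀

-- The recurrence of the closed form

alternatingSum : ℕ → Series
alternatingSum k = ∑ˢ[ j < k ] (-1ℤ ^ j) ·ˢ ⟨ q^ (k ∸ j) ⟩ j

-- The term j = 0 is 1. In the term j + 1 the base exponent is (k+1) - (j+1) = k - j, so the last
-- factor is 1 - q^k for every j and comes out of the sum.
alternatingSum-suc : ∀ k → alternatingSum (suc k) ≗
                     1ˢ +ˢ (-1ℤ ·ˢ alternatingSum k +ˢ shift k (alternatingSum k))
alternatingSum-suc k n = begin
  alternatingSum (suc k) n
    ≡⟨ cong₂ ℤ._+_ (ℤ.*-identityˡ (1ˢ n))
         (sumˢ-cong k (λ j → (-1ℤ ^ suc j) ·ˢ ⟨ q^ (k ∸ j) ⟩ suc j)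
                      (λ j → -1ℤ ·ˢ t j +ˢ shift k (t j)) n term) ⟩
  1ˢ n ℤ.+ sumˢ k (λ j → -1ℤ ·ˢ t j +ˢ shift k (t j)) n
    ≡⟨ cong (ℤ._+_ (1ˢ n)) (trans (sumˢ-+ˢ k (λ j → -1ℤ ·ˢ t j) (λ j → shift k (t j)) n)
         (cong₂ ℤ._+_ (sumˢ-·ˢ k -1ℤ t n) (sumˢ-shift k k t n))) ⟩
  1ˢ n ℤ.+ (-1ℤ ℤ.* alternatingSum k n ℤ.+ shift k (alternatingSum k) n)  ∎
  where
  t : ℕ → Series
  t j = (-1ℤ ^ j) ·ˢ ⟨ q^ (k ∸ j) ⟩ j

  distrib : ∀ c x y → -1ℤ ℤ.* c ℤ.* (x ℤ.- y) ≡ -1ℤ ℤ.* (c ℤ.* x) ℤ.+ c ℤ.* y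
  distrib = solve-∀

  term : ∀ j → j < k → (-1ℤ ^ suc j) ℤ.* (⟨ q^ (k ∸ j) ⟩ suc j) n ≡
                       -1ℤ ℤ.* t j n ℤ.+ shift k (t j) n
  term j j<k = begin
    (-1ℤ ^ suc j) ℤ.* (⟨ q^ (k ∸ j) ⟩ suc j) n
      ≡⟨ cong (ℤ._*_ (-1ℤ ^ suc j)) (⟨q^⟩-suc (k ∸ j) j n) ⟩
    (-1ℤ ^ suc j) ℤ.* (X n ℤ.- shift (k ∸ j + j) X n)
      -- As `j < k`, the truncated subtraction is a true one and (k - j) + j = k.
      ≡⟨ cong (λ m → (-1ℤ ^ suc j) ℤ.* (X n ℤ.- shift m X n)) (m∸n+n≡m (<⇒≤ j<k)) ⟩
    (-1ℤ ^ suc j) ℤ.* (X n ℤ.- shift k X n)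
      ≡⟨ distrib (-1ℤ ^ j) (X n) (shift k X n) ⟩
    -1ℤ ℤ.* t j n ℤ.+ (-1ℤ ^ j) ℤ.* shift k X n
      ≡⟨ cong (ℤ._+_ (-1ℤ ℤ.* t j n)) (shift-·ˢ k (-1ℤ ^ j) X n) ⟨
    -1ℤ ℤ.* t j n ℤ.+ shift k (t j) n  ∎
    where
    X = ⟨ q^ (k ∸ j) ⟩ j

closedForm : ℕ → Series
closedForm k = (+ 2) ·ˢ (⟨ -ˢ q^ 1 ⟩∞ *ˢ alternatingSum k) +ˢ (-1ℤ ^ k) ·ˢ ⟨ q^ 1 ⟩ (k ∸ 1)

closedForm-1 : closedForm 1 ≗ (+ 2) ·ˢ ⟨ -ˢ q^ 1 ⟩∞ -ˢ 1ˢ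
closedForm-1 n = cong₂ (λ x y → + 2 ℤ.* x ℤ.+ y)
  (trans (*ˢ-congˡ ⟨ -ˢ q^ 1 ⟩∞ alternatingSum-1 n) (*ˢ-identityʳ ⟨ -ˢ q^ 1 ⟩∞ n))
  (ℤ.-1*i≡-i (1ˢ n))
  where
  alternatingSum-1 : alternatingSum 1 ≗ 1ˢ
  alternatingSum-1 i = trans (ℤ.+-identityʳ _) (ℤ.*-identityˡ (1ˢ i))

-- The new term 1 of the alternating sum gives 2 (-q;q)∞; everything else is multiplied by -(1 -
-- q^k), which for the last summand is (q;q)_k = (1 - q^k) (q;q)_(k-1). At k = 0 that identity
-- fails, as `k ∸ 1` is truncated.
closedForm-recurrence : ∀ k .{{_ : NonZero k}} → closedForm (suc k) +ˢ closedForm k ≗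
                        (+ 2) ·ˢ ⟨ -ˢ q^ 1 ⟩∞ +ˢ shift k (closedForm k)
closedForm-recurrence k@(suc k-1) n = begin
  closedForm (suc k) n ℤ.+ closedForm k n
    ≡⟨ cong₂ (λ x y → (+ 2 ℤ.* x ℤ.+ (-1ℤ ^ suc k) ℤ.* y) ℤ.+ closedForm k n)
             P*suc (⟨q^⟩-suc 1 k-1 n) ⟩
  (+ 2 ℤ.* (P n ℤ.+ (-1ℤ ℤ.* (P *ˢ A) n ℤ.+ shift k (P *ˢ A) n))
    ℤ.+ (-1ℤ ^ suc k) ℤ.* (Q n ℤ.- shift k Q n)) ℤ.+ closedForm k n
    ≡⟨ rearrange (P n) ((P *ˢ A) n) (shift k (P *ˢ A) n) (-1ℤ ^ k) (Q n) (shift k Q n) ⟩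
  + 2 ℤ.* P n ℤ.+ (+ 2 ℤ.* shift k (P *ˢ A) n ℤ.+ (-1ℤ ^ k) ℤ.* shift k Q n)
    ≡⟨ cong (ℤ._+_ (+ 2 ℤ.* P n)) (trans (shift-+ˢ k _ _ n)
         (cong₂ ℤ._+_ (shift-·ˢ k (+ 2) (P *ˢ A) n) (shift-·ˢ k (-1ℤ ^ k) Q n))) ⟨
  + 2 ℤ.* P n ℤ.+ shift k (closedForm k) n  ∎
  where
  P = ⟨ -ˢ q^ 1 ⟩∞
  Q = ⟨ q^ 1 ⟩ k-1
  A = alternatingSum k

  P*suc : (P *ˢ alternatingSum (suc k)) n ≡ P n ℤ.+ (-1ℤ ℤ.* (P *ˢ A) n ℤ.+ shift k (P *ˢ A) n)
  P*suc = begin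
    (P *ˢ alternatingSum (suc k)) n
      ≡⟨ *ˢ-congˡ P (alternatingSum-suc k) n ⟩
    (P *ˢ (1ˢ +ˢ (-1ℤ ·ˢ A +ˢ shift k A))) n
      ≡⟨ *ˢ-distribˡ-+ˢ P 1ˢ (-1ℤ ·ˢ A +ˢ shift k A) n ⟩
    (P *ˢ 1ˢ) n ℤ.+ (P *ˢ (-1ℤ ·ˢ A +ˢ shift k A)) n
      ≡⟨ cong₂ ℤ._+_ (*ˢ-identityʳ P n) (*ˢ-distribˡ-+ˢ P (-1ℤ ·ˢ A) (shift k A) n) ⟩
    P n ℤ.+ ((P *ˢ (-1ℤ ·ˢ A)) n ℤ.+ (P *ˢ shift k A) n)
      ≡⟨ cong (ℤ._+_ (P n)) (cong₂ ℤ._+_ (*ˢ-·ˢ -1ℤ P A n) (*ˢ-shift k P A n)) ⟩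
    P n ℤ.+ (-1ℤ ℤ.* (P *ˢ A) n ℤ.+ shift k (P *ˢ A) n)  ∎

  rearrange : ∀ p a a′ c b b′ →
    (+ 2 ℤ.* (p ℤ.+ (-1ℤ ℤ.* a ℤ.+ a′)) ℤ.+ -1ℤ ℤ.* c ℤ.* (b ℤ.- b′))
      ℤ.+ (+ 2 ℤ.* a ℤ.+ c ℤ.* b) ≡
    + 2 ℤ.* p ℤ.+ (+ 2 ℤ.* a′ ℤ.+ c ℤ.* b′)
  rearrange = solve-∀

-- Induction on `k` from k = 1, comparing coefficients of finite sums that are long enough, so that
-- no limit has to be taken inside the recurrence.
partialSum≡closedForm : ∀ k .{{_ : NonZero k}} N n → n < N → partialSum k N n ≡ closedForm k n
partialSum≡closedForm 1 N n n<N = trans (partialSum-1 N n n<N) (sym (closedForm-1 n))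
partialSum≡closedForm (suc k@(suc _)) (suc N) n (s≤s n≤N) =
  ℤ-+-cancelʳ (partialSum k (suc N) n) _ _ (begin
  partialSum (suc k) (suc N) n ℤ.+ partialSum k (suc N) n
    ≡⟨ partialSum-recurrence k N n ⟩
  + 2 ℤ.* ⟨ -ˢ q^ 1 ⟩∞ n ℤ.+ shift k (partialSum k N) n
    -- Only coefficients `m` with k + m ≤ n ≤ N matter. As k is positive, `m < N`, so the sum that
    -- is one term shorter still suffices.
    ≡⟨ cong (ℤ._+_ (+ 2 ℤ.* ⟨ -ˢ q^ 1 ⟩∞ n)) (shift-cong-≤ k n λ m k+m≤n →
         partialSum≡closedForm k N m (<-≤-trans (m<n+m m (s≤s z≤n)) (≤-trans k+m≤n n≤N))) ⟩
  + 2 ℤ.* ⟨ -ˢ q^ 1 ⟩∞ n ℤ.+ shift k (closedForm k) n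
    ≡⟨ closedForm-recurrence k n ⟨
  closedForm (suc k) n ℤ.+ closedForm k n
    ≡⟨ cong (ℤ._+_ (closedForm (suc k) n)) (partialSum≡closedForm k (suc N) n (s≤s n≤N)) ⟨
  closedForm (suc k) n ℤ.+ partialSum k (suc N) n  ∎)

-- Counting by duplicate-free lists

-- Without repetitions, having the same members means being permutations of each other. This takes
-- the place of an explicit bijection between two enumerations of the partitions.
unique∧⇔⇒length≡ : ∀ {A : Set} {xs ys : List A} → Unique xs → Unique ys →
                   (∀ {z} → z ∈ xs ⇔ z ∈ ys) → length xs ≡ length ys
unique∧⇔⇒length≡ xs! ys! xs⇔ys = ↭-length (∼bag⇒↭ (unique∧set⇒bag xs! ys! xs⇔ys))

-- Generating functions of lists of partitions

gf : List (List ℕ) → Series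
gf []         n = 0ℤ
gf (xs ∷ xss) n = (q^ sum xs) n ℤ.+ gf xss n

gf≡length-filter : ∀ xss n → gf xss n ≡ + length (filter (λ xs → sum xs ≟ n) xss)
gf≡length-filter []         n = refl
gf≡length-filter (xs ∷ xss) n with sum xs ≟ n
... | yes p = trans (cong (ℤ._+_ 1ℤ) (gf≡length-filter xss n))
                    (cong (+_ ∘ length) (sym (filter-accept (λ ys → sum ys ≟ n) {xs} {xss} p)))
... | no ¬p = trans (trans (ℤ.+-identityˡ _) (gf≡length-filter xss n))
                    (cong (+_ ∘ length) (sym (filter-reject (λ ys → sum ys ≟ n) {xs} {xss} ¬p)))

gf-++ : ∀ xss yss → gf (xss ++ yss) ≗ gf xss +ˢ gf yss
gf-++ []         yss n = sym (ℤ.+-identityˡ _)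
gf-++ (xs ∷ xss) yss n = trans
  (cong (ℤ._+_ ((q^ sum xs) n)) (gf-++ xss yss n))
  (sym (ℤ.+-assoc ((q^ sum xs) n) (gf xss n) (gf yss n)))

gf-map : ∀ s f → (∀ xs → sum (f xs) ≡ s + sum xs) → ∀ xss → gf (map f xss) ≗ shift s (gf xss)
gf-map s f sum-f []         n = sym (shift-0ˢ s n)
gf-map s f sum-f (xs ∷ xss) n = begin
  (q^ sum (f xs)) n ℤ.+ gf (map f xss) n
    ≡⟨ cong₂ ℤ._+_ (trans (cong (λ m → (q^ m) n) (sum-f xs)) (sym (shift-q^ s (sum xs) n)))
                   (gf-map s f sum-f xss n) ⟩
  shift s (q^ sum xs) n ℤ.+ shift s (gf xss) n
    ≡⟨ shift-+ˢ s (q^ sum xs) (gf xss) n ⟨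
  shift s (gf (xs ∷ xss)) n  ∎

-- Partitions into distinct parts

-- The parts lie in the interval [m , m + N).
distinct : ℕ → ℕ → List (List ℕ)
distinct m zero    = [] ∷ []
distinct m (suc N) = distinct m N ++ map (m + N ∷_) (distinct m N)

-- The largest admissible part m + N is either absent or present, which is the factor 1 + q^(m+N) of
-- the product.
gf-distinct : ∀ m N → gf (distinct m N) ≗ ⟨ -ˢ q^ m ⟩ N
gf-distinct m zero    n = ℤ.+-identityʳ (1ˢ n)
gf-distinct m (suc N) n = begin
  gf (distinct m N ++ map (m + N ∷_) (distinct m N)) n
    ≡⟨ gf-++ (distinct m N) _ n ⟩
  gf (distinct m N) n ℤ.+ gf (map (m + N ∷_) (distinct m N)) n
    ≡⟨ cong₂ ℤ._+_ (gf-distinct m N n)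
         (trans (gf-map (m + N) (m + N ∷_) (λ _ → refl) (distinct m N) n)
                (shift-cong (m + N) (gf-distinct m N) n)) ⟩
  (⟨ -ˢ q^ m ⟩ N) n ℤ.+ shift (m + N) (⟨ -ˢ q^ m ⟩ N) n
    ≡⟨ ⟨-q^⟩-suc m N n ⟨
  (⟨ -ˢ q^ m ⟩ suc N) n  ∎

∈-distinct⁻ : ∀ m N {xs} → xs ∈ distinct m N →
              AllPairs _>_ xs × All (m ≤_) xs × All (_< m + N) xs
∈-distinct⁻ m zero    (here refl) = [] , [] , []
∈-distinct⁻ m (suc N) xs∈ with ∈-++⁻ (distinct m N) xs∈
... | inj₁ xs∈ˡ with dec , low , high ← ∈-distinct⁻ m N xs∈ˡ =
  dec , low , All.map (λ x< → <-trans x< (+-monoʳ-< m ≤-refl)) high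
... | inj₂ xs∈ʳ with ys , ys∈ , refl ← ∈-map⁻ (m + N ∷_) xs∈ʳ
                with dec , low , high ← ∈-distinct⁻ m N ys∈ =
  high ∷ dec , m≤m+n m N ∷ low ,
  +-monoʳ-< m ≤-refl ∷ All.map (λ x< → <-trans x< (+-monoʳ-< m ≤-refl)) high

-- The head is the largest part, so comparing it with m + N decides which half of the enumeration
-- contains the list.
∈-distinct⁺ : ∀ m N {xs} → AllPairs _>_ xs → All (m ≤_) xs → All (_< m + N) xs →
              xs ∈ distinct m N
∈-distinct⁺ m N       []          _           _            = []∈ N
  where
  []∈ : ∀ N → [] ∈ distinct m N
  []∈ zero    = here refl
  []∈ (suc N) = ∈-++⁺ˡ ([]∈ N)
∈-distinct⁺ m zero    (_ ∷ _)     (m≤x ∷ _)   (x<m ∷ _)    =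
  contradiction (subst (_ <_) (+-identityʳ m) x<m) (≤⇒≯ m≤x)
∈-distinct⁺ m (suc N) {x ∷ xs} (x> ∷ dec) (m≤x ∷ low) (x< ∷ high) with x ≟ m + N
... | yes refl = ∈-++⁺ʳ (distinct m N) (∈-map⁺ (m + N ∷_) (∈-distinct⁺ m N dec low x>))
... | no  x≢   = ∈-++⁺ˡ (∈-distinct⁺ m N (x> ∷ dec) (m≤x ∷ low)
                   (x<m+N ∷ All.map (λ y<x → <-trans y<x x<m+N) x>))
  where
  x<m+N : x < m + N
  x<m+N = ≤∧≢⇒< (≤-pred (subst (x <_) (+-suc m N) x<)) x≢

distinct-unique : ∀ m N → Unique (distinct m N)
distinct-unique m zero    = [] ∷ []
distinct-unique m (suc N) = Unique.++⁺ (distinct-unique m N)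
  (Unique.map⁺ ∷-injectiveʳ (distinct-unique m N)) λ (xs∈ , xs∈′) → disjoint xs∈ xs∈′
  where
  disjoint : ∀ {xs} → xs ∈ distinct m N → xs ∈ map (m + N ∷_) (distinct m N) → _
  disjoint xs∈ xs∈′ with _ , _ , refl ← ∈-map⁻ (m + N ∷_) xs∈′
                    with _ , _ , m+N<m+N ∷ _ ← ∈-distinct⁻ m N xs∈ = <-irrefl refl m+N<m+N

-- Partitions counted by D k

-- The smallest part lies in [m , m + M), the others exceed it by at most N.
candidates : (k N m M : ℕ) → List (List ℕ)
candidates k N m zero    = []
candidates k N m (suc M) =
  map (_++ replicate k m) (distinct (suc m) N) ++ candidates k N (suc m) M

sum-replicate : ∀ k m → sum (replicate k m) ≡ k * m
sum-replicate zero    m = refl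
sum-replicate (suc k) m = cong (_+_ m) (sum-replicate k m)

-- For smallest part i, its k copies contribute q^(ik), and the distinct parts above it contribute
-- (-q^(i+1);q)_N.
gf-candidates : ∀ k N m M →
  gf (candidates k N m M) ≗ ∑ˢ[ i < M ] shift ((m + i) * k) (⟨ -ˢ q^ suc (m + i) ⟩ N)
gf-candidates k N m zero    n = refl
gf-candidates k N m (suc M) n = begin
  gf (map (_++ replicate k m) (distinct (suc m) N) ++ candidates k N (suc m) M) n
    ≡⟨ gf-++ (map (_++ replicate k m) (distinct (suc m) N)) _ n ⟩
  gf (map (_++ replicate k m) (distinct (suc m) N)) n ℤ.+ gf (candidates k N (suc m) M) n
    ≡⟨ cong₂ ℤ._+_
         (trans (gf-map (m * k) (_++ replicate k m) sum-++-replicate (distinct (suc m) N) n)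
                (shift-cong (m * k) (gf-distinct (suc m) N) n))
         (gf-candidates k N (suc m) M n) ⟩
  t m n ℤ.+ sumˢ M (λ i → t (suc m + i)) n
    ≡⟨ cong₂ ℤ._+_ (cong (λ i → t i n) (sym (+-identityʳ m)))
         (sumˢ-cong M (λ i → t (suc m + i)) (λ i → t (m + suc i)) n
           λ i _ → cong (λ j → t j n) (sym (+-suc m i))) ⟩
  t (m + 0) n ℤ.+ sumˢ M (λ i → t (m + suc i)) n  ∎
  where
  t : ℕ → Series
  t i = shift (i * k) (⟨ -ˢ q^ suc i ⟩ N)

  sum-++-replicate : ∀ xs → sum (xs ++ replicate k m) ≡ m * k + sum xs
  sum-++-replicate xs = begin
    sum (xs ++ replicate k m)       ≡⟨ sum-++ xs (replicate k m) ⟩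
    sum xs + sum (replicate k m)    ≡⟨ cong (_+_ (sum xs)) (trans (sum-replicate k m) (*-comm k m)) ⟩
    sum xs + m * k                  ≡⟨ +-comm (sum xs) (m * k) ⟩
    m * k + sum xs                  ∎

record IsCandidate (k N m M : ℕ) (xs : List ℕ) : Set where
  constructor isCandidate
  field
    least      : ℕ
    m≤least    : m ≤ least
    least<m+M  : least < m + M
    others     : List ℕ
    others∈    : others ∈ distinct (suc least) N
    split      : xs ≡ others ++ replicate k least

∈-candidates⁻ : ∀ k N m M {xs} → xs ∈ candidates k N m M → IsCandidate k N m M xs
∈-candidates⁻ k N m (suc M) xs∈
  with ∈-++⁻ (map (_++ replicate k m) (distinct (suc m) N)) xs∈
... | inj₁ xs∈ˡ with ys , ys∈ , eq ← ∈-map⁻ (_++ replicate k m) xs∈ˡ =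
  isCandidate m ≤-refl (m<m+n m (s≤s z≤n)) ys ys∈ eq
... | inj₂ xs∈ʳ with isCandidate l m<l l< ys ys∈ eq ← ∈-candidates⁻ k N (suc m) M xs∈ʳ =
  isCandidate l (<⇒≤ m<l) (subst (l <_) (sym (+-suc m M)) l<) ys ys∈ eq

∈-candidates⁺ : ∀ k N m M {xs} → IsCandidate k N m M xs → xs ∈ candidates k N m M
∈-candidates⁺ k N m zero (isCandidate l m≤l l< _ _ _) =
  contradiction (subst (l <_) (+-identityʳ m) l<) (≤⇒≯ m≤l)
∈-candidates⁺ k N m (suc M) (isCandidate l m≤l l< ys ys∈ refl) with m ≟ l
... | yes refl = ∈-++⁺ˡ (∈-map⁺ (_++ replicate k m) ys∈)
... | no  m≢l  = ∈-++⁺ʳ (map (_++ replicate k m) (distinct (suc m) N))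
  (∈-candidates⁺ k N (suc m) M
    (isCandidate l (≤∧≢⇒< m≤l m≢l) (subst (l <_) (+-suc m M) l<) ys ys∈ refl))

-- As k is positive, a list of the first block really contains `m`, while all parts of a list from
-- the later blocks exceed `m`; so the blocks are disjoint.
candidates-unique : ∀ k .{{_ : NonZero k}} N m M → Unique (candidates k N m M)
candidates-unique k         N m zero    = []
candidates-unique k@(suc _) N m (suc M) = Unique.++⁺
  (Unique.map⁺ (++-cancelʳ (replicate k m) _ _) (distinct-unique (suc m) N))
  (candidates-unique k N (suc m) M)
  λ (xs∈ , xs∈′) → disjoint xs∈ xs∈′
  where
  disjoint : ∀ {xs} → xs ∈ map (_++ replicate k m) (distinct (suc m) N) →
             xs ∈ candidates k N (suc m) M → _
  disjoint xs∈ xs∈′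
    with ys , ys∈ , refl ← ∈-map⁻ (_++ replicate k m) xs∈
    with isCandidate l m<l _ zs zs∈ eq ← ∈-candidates⁻ k N (suc m) M xs∈′
    = <-irrefl refl (All.lookup m<parts (∈-++⁺ʳ ys (here refl)))
    where
    m<parts : All (m <_) (ys ++ replicate k m)
    m<parts = subst (All (m <_)) (sym eq) (All.++⁺
      (All.map (λ l<x → <-trans m<l l<x) (proj₁ (proj₂ (∈-distinct⁻ (suc l) N zs∈))))
      (All.replicate⁺ k m<l))

-- Multiplicities

multiplicity-++ : ∀ x ys zs →
  multiplicity x (ys ++ zs) ≡ multiplicity x ys + multiplicity x zs
multiplicity-++ x ys zs =
  trans (cong length (filter-++ (x ≟_) ys zs)) (length-++ (filter (x ≟_) ys))

multiplicity-replicate : ∀ k m → multiplicity m (replicate k m) ≡ k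
multiplicity-replicate k m = trans
  (cong length (filter-all (m ≟_) (All.replicate⁺ k refl))) (length-replicate k)

multiplicity-here : ∀ x xs → multiplicity x (x ∷ xs) ≡ suc (multiplicity x xs)
multiplicity-here x xs = cong length (filter-accept (x ≟_) refl)

multiplicity-there : ∀ {x y} xs → x ≢ y → multiplicity x (y ∷ xs) ≡ multiplicity x xs
multiplicity-there xs x≢y = cong length (filter-reject (_ ≟_) x≢y)

multiplicity-∷-≤ : ∀ x y ys → multiplicity x ys ≤ multiplicity x (y ∷ ys)
multiplicity-∷-≤ x y ys with x ≟ y
... | yes refl = ≤-trans (n≤1+n _) (≤-reflexive (sym (multiplicity-here x ys)))
... | no  x≢y  = ≤-reflexive (sym (multiplicity-there ys x≢y))

multiplicity≤1 : ∀ x {ys} → AllPairs _>_ ys → multiplicity x ys ≤ 1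
multiplicity≤1 x []                       = z≤n
multiplicity≤1 x {y ∷ ys} (y> ∷ dec) with x ≟ y
... | yes refl = ≤-reflexive (trans (multiplicity-here x ys)
                   (cong suc (multiplicity-∉ x ys (All.map >⇒≢ y>))))
... | no  x≢y  = subst (_≤ 1) (sym (multiplicity-there ys x≢y)) (multiplicity≤1 x dec)

multiplicity≡0⇒∉ : ∀ x ys → multiplicity x ys ≡ 0 → All (x ≢_) ys
multiplicity≡0⇒∉ x []       _ = []
multiplicity≡0⇒∉ x (y ∷ ys) p with x ≟ y
... | yes refl = contradiction (trans (sym (multiplicity-here x ys)) p) λ ()
... | no  x≢y  = x≢y ∷ multiplicity≡0⇒∉ x ys (trans (sym (multiplicity-there ys x≢y)) p)

-- The shape of the partitions counted by `D k`

replicate-AllPairs : ∀ k m → AllPairs _≥_ (replicate k m)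
replicate-AllPairs zero    m = []
replicate-AllPairs (suc k) m = All.replicate⁺ k ≤-refl ∷ replicate-AllPairs k m

isDPartition⁺ : ∀ k .{{_ : NonZero k}} m {ys} → AllPairs _>_ ys → All (m <_) ys →
                IsDPartition k (sum (ys ++ replicate k m)) (ys ++ replicate k m)
isDPartition⁺ k@(suc _) m {ys} dec m<ys = record
  { weaklyDecreasing      = AllPairs⇒Linked (AllPairs.++⁺
      (AllPairs.map <⇒≤ dec) (replicate-AllPairs k m)
      (All.map (λ m<y → All.replicate⁺ k (<⇒≤ m<y)) m<ys))
  ; total                 = refl
  ; smallest              = m
  ; smallest∈parts        = ∈-++⁺ʳ ys (here refl)
  ; smallest≤parts        = All.++⁺ (All.map <⇒≤ m<ys) (All.replicate⁺ k ≤-refl)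
  ; multiplicity-smallest = trans (multiplicity-++ m ys (replicate k m))
      (cong₂ _+_ (multiplicity-∉ m ys (All.map <⇒≢ m<ys)) (multiplicity-replicate k m))
  ; multiplicity-others   = λ x x≢m → subst (_≤ 1)
      (sym (trans (multiplicity-++ x ys (replicate k m))
        (trans (cong (_+_ (multiplicity x ys))
                 (multiplicity-∉ x (replicate k m) (All.replicate⁺ k x≢m)))
               (+-identityʳ _))))
      (multiplicity≤1 x dec)
  }

all-equal⇒replicate : ∀ {m : ℕ} {xs} → All (m ≡_) xs → xs ≡ replicate (multiplicity m xs) m
all-equal⇒replicate []            = refl
all-equal⇒replicate {m} {_ ∷ xs} (refl ∷ m≡xs) = begin
  m ∷ xs                                    ≡⟨ cong (m ∷_) (all-equal⇒replicate m≡xs) ⟩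
  replicate (suc (multiplicity m xs)) m     ≡⟨ cong (λ l → replicate l m) (multiplicity-here m xs) ⟨
  replicate (multiplicity m (m ∷ xs)) m     ∎

-- Induction along the list. If the head is `m`, weak decrease squeezes every later part to `m` as
-- well. Otherwise the head occurs only once, so it lies strictly above the tail and joins the
-- distinct parts.
split-smallest : ∀ m {xs} → AllPairs _≥_ xs → All (m ≤_) xs →
  (∀ x → x ≢ m → multiplicity x xs ≤ 1) →
  ∃[ ys ] AllPairs _>_ ys × All (m <_) ys × xs ≡ ys ++ replicate (multiplicity m xs) m
split-smallest m []         _            _      = [] , [] , [] , refl
split-smallest m {x ∷ xs} (x≥ ∷ dec) (m≤x ∷ m≤xs) others with m ≟ x
... | yes refl = [] , [] , [] , all-equal⇒replicate {xs = m ∷ xs}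
  (refl ∷ All.zipWith (λ (y≤m , m≤y) → ≤-antisym m≤y y≤m) (x≥ , m≤xs))
... | no m≢x with split-smallest m dec m≤xs others′
  where
  others′ : ∀ y → y ≢ m → multiplicity y xs ≤ 1
  others′ y y≢m = ≤-trans (multiplicity-∷-≤ y x xs) (others y y≢m)
...   | ys , dec′ , m<ys , eq =
  x ∷ ys , x>ys ∷ dec′ , ≤∧≢⇒< m≤x m≢x ∷ m<ys ,
  cong (x ∷_) (trans eq (cong (λ l → ys ++ replicate l m) (sym (multiplicity-there xs m≢x))))
  where
  -- The head already uses up the single occurrence allowed to `x`.
  x∉xs : All (x ≢_) xs
  x∉xs = multiplicity≡0⇒∉ x xs (n<1⇒n≡0
    (subst (_≤ 1) (multiplicity-here x xs) (others x (m≢x ∘ sym))))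

  x>ys : All (x >_) ys
  x>ys = All.++⁻ˡ ys (subst (All (x >_)) eq
    (All.zipWith (λ (y≤x , x≢y) → ≤∧≢⇒< y≤x (x≢y ∘ sym)) (x≥ , x∉xs)))

isDPartition⁻ : ∀ {k n xs} (p : IsDPartition k n xs) → ∃[ ys ] AllPairs _>_ ys ×
  All (IsDPartition.smallest p <_) ys × xs ≡ ys ++ replicate k (IsDPartition.smallest p)
isDPartition⁻ p
  with ys , dec , low , eq ← split-smallest _
         (Linked⇒AllPairs (λ x≥y y≥z → ≤-trans y≥z x≥y) (IsDPartition.weaklyDecreasing p))
         (IsDPartition.smallest≤parts p) (IsDPartition.multiplicity-others p)
  = ys , dec , low , trans eq (cong (λ l → ys ++ replicate l smallest) multiplicity-smallest)
  where open IsDPartition p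

-- Coefficients of the partial sums

-- All parts of a partition of `n` are at most n < N. So N choices of the smallest part, and N
-- factors in each product, capture every partition counted.
partialSum≡D : ∀ k .{{_ : NonZero k}} N n → n < N → partialSum k N n ≡ + D k n
partialSum≡D k N n n<N = begin
  partialSum k N n
    ≡⟨ sumˢ-cong N (λ i → shift (i * k) ⟨ -ˢ q^ suc i ⟩∞)
                   (λ i → shift (i * k) (⟨ -ˢ q^ suc i ⟩ N)) n
         (λ i _ → shift-cong-≤ (i * k) n λ j ik+j≤n →
           sym (⟨⟩∞-stable (-ˢ q^ suc i) N j (≤-<-trans (m+n≤o⇒n≤o (i * k) ik+j≤n) n<N))) ⟩
  sumˢ N (λ i → shift (i * k) (⟨ -ˢ q^ suc i ⟩ N)) n
    ≡⟨ gf-candidates k N 0 N n ⟨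
  gf (candidates k N 0 N) n
    ≡⟨ gf≡length-filter (candidates k N 0 N) n ⟩
  + length partitions
    ≡⟨ cong +_ (unique∧⇔⇒length≡ (Unique.filter⁺ sum? (candidates-unique k N 0 N))
         (dPartitions-unique k n) (mk⇔ to from)) ⟩
  + D k n  ∎
  where
  sum? = λ xs → sum xs ≟ n

  partitions : List (List ℕ)
  partitions = filter sum? (candidates k N 0 N)

  to : ∀ {xs} → xs ∈ partitions → xs ∈ dPartitions k n
  to xs∈
    with xs∈c , refl ← ∈-filter⁻ sum? {xs = candidates k N 0 N} xs∈
    with isCandidate l _ _ ys ys∈ refl ← ∈-candidates⁻ k N 0 N xs∈c
    with dec , low , _ ← ∈-distinct⁻ (suc l) N ys∈ =
    Equivalence.from (∈-dPartitions k n _) (isDPartition⁺ k l dec low)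

  from : ∀ {xs} → xs ∈ dPartitions k n → xs ∈ partitions
  from {xs} xs∈ with p ← Equivalence.to (∈-dPartitions k n xs) xs∈
                with ys , dec , low , eq ← isDPartition⁻ p =
    ∈-filter⁺ sum? (∈-candidates⁺ k N 0 N
      (isCandidate smallest z≤n (All.lookup parts<N smallest∈parts) ys
        (∈-distinct⁺ (suc smallest) N dec low
          -- `∈-distinct⁺` asks for parts below `suc smallest + N`, which is weaker than being below
          -- `N`.
          (All.map (λ x<N → <-≤-trans x<N (m≤n+m N (suc smallest)))
            (All.++⁻ˡ ys (subst (All (_< N)) eq parts<N))))
        eq))
      total
    where
    open IsDPartition p

    parts<N : All (_< N) xs
    parts<N = All.map (λ x≤ → ≤-<-trans x≤ (subst (_< N) (sym total) n<N)) (parts≤sum xs)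

theorem10 : ∀ (k : ℕ) .{{_ : NonZero k}} →
    HasSum (λ n → q^ (n * k) *ˢ ⟨ -ˢ q^ (suc n) ⟩∞) (λ n → + D k n)
    × (λ n → + D k n) ≗
    (+ 2) ·ˢ (⟨ -ˢ q^ 1 ⟩∞ *ˢ (∑ˢ[ j < k ] (-1ℤ ^ j) ·ˢ ⟨ q^ (k ∸ j) ⟩ j))
    +ˢ (-1ℤ ^ k) ·ˢ ⟨ q^ 1 ⟩ (k ∸ 1)
theorem10 k = hasSum , λ n →
  -- Coefficient `n` is settled by the first `suc n` terms, so both sides are compared with that one
  -- partial sum.
  trans (sym (partialSum≡D k (suc n) n ≤-refl)) (partialSum≡closedForm k (suc n) n ≤-refl)
  where
  hasSum : HasSum (λ n → q^ (n * k) *ˢ ⟨ -ˢ q^ (suc n) ⟩∞) (λ n → + D k n)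
  hasSum n = suc n , λ N n<N → trans
    (sumˢ-cong N (λ i → q^ (i * k) *ˢ ⟨ -ˢ q^ (suc i) ⟩∞)
                 (λ i → shift (i * k) ⟨ -ˢ q^ suc i ⟩∞) n
      λ i _ → q^-*ˢ (i * k) ⟨ -ˢ q^ suc i ⟩∞ n)
    (partialSum≡D k N n n<N)
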